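{- Let $A$ be an $n\times n$ matrix with all entries in $\{+1,-1\}$, and let $m$ be an integer with $2 \le m \le 6$. Define $n_0(2)=3$, $n_0(3)=5$, $n_0(4)=8$, $n_0(5)=15$, $n_0(6)=45$. If $n \ge n_0(m)$, then $A$ has a singular $m\times m$ submatrix.
   Context: An $m\times m$ submatrix of $A$ is obtained by choosing $m$ of the rows and $m$ of the columns of $A$ (not necessarily consecutive). Singular means having determinant zero. -}

module Defs where

open import Algebra.Properties.Monoid.Sum using (sum)
open import Data.Fin.Base as Fin using (Fin; zero; suc; toℕ)
open import Data.Integer.Base using (ℤ; 0ℤ; 1ℤ; -1ℤ; _*_; _^_)
open import Data.Integer.Properties using (+-0-monoid)
open import Data.Nat.Base using (ℕ; zero; suc; _≤_; s≤s)
open import Data.Product.Base using (∃₂)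
open import Data.Sum.Base using (_⊎_)
open import Data.Vec.Functional using (Vector; removeAt)
open import Relation.Binary.Core using (_Preserves_⟶_)
open import Relation.Binary.PropositionalEquality.Core using (_≡_)

Matrix : ℕ → ℕ → Set
Matrix m n = Vector (Vector ℤ n) m

minor₀ : ∀ {n} → Matrix (suc n) (suc n) → Fin (suc n) → Matrix n n
minor₀ M j i = removeAt (M (suc i)) j

-- Laplace expansion along the first row.
det : ∀ {n} → Matrix n n → ℤ
det {zero}  M = 1ℤ
det {suc n} M =
  sum +-0-monoid (λ j → -1ℤ ^ toℕ j * M zero j * det (minor₀ M j))

Singular : ∀ {n} → Matrix n n → Set
Singular M = det M ≡ 0ℤ

SignMatrix : ∀ {m n} → Matrix m n → Set
SignMatrix A = ∀ i j → A i j ≡ 1ℤ ⊎ A i j ≡ -1ℤ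

-- A choice of m out of n indices, as its strictly increasing enumeration.
record Selection (m n : ℕ) : Set where
  field
    index      : Fin m → Fin n
    increasing : index Preserves Fin._<_ ⟶ Fin._<_

open Selection public

submatrix : ∀ {m n k l} → Matrix m n → Selection k m → Selection l n → Matrix k l
submatrix A r c i j = A (index r i) (index c j)

HasSingularSubmatrix : ∀ {n} → ℕ → Matrix n n → Set
HasSingularSubmatrix {n} m A =
  ∃₂ λ (r c : Selection m n) → Singular (submatrix A r c)

n₀ : ∀ m → 2 ≤ m → m ≤ 6 → ℕ
n₀ 0 () _
n₀ 1 (s≤s ()) _
n₀ 2 _ _ = 3
n₀ 3 _ _ = 5
n₀ 4 _ _ = 8
n₀ 5 _ _ = 15
n₀ 6 _ _ = 45
n₀ (suc (suc (suc (suc (suc (suc (suc _))))))) _ (s≤s (s≤s (s≤s (s≤s (s≤s (s≤s ()))))))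

{-# OPTIONS --safe #-}

-- On any column, two rows of signs agree or are opposite. So among 2m − 1
-- columns there are m on which the first two rows are proportional, and an
-- m × m submatrix containing both rows on those columns is singular. Every
-- n₀(m) is at least 2m − 1.

module Submission where

open import Defs
open import Algebra.Properties.CommutativeMonoid.Sum using (∑-distrib-+)
open import Algebra.Properties.Monoid.Sum using (sum; sum-cong-≗; sum-replicate-zero)
open import Algebra.Properties.Semiring.Sum using (*-distribˡ-sum)
open import Data.Fin.Base as Fin using (Fin; zero; suc; toℕ; inject₁; inject≤; punchIn)
open import Data.Fin.Properties using (toℕ-inject₁; toℕ-inject≤)
open import Data.Integer.Base using (ℤ; 0ℤ; 1ℤ; -1ℤ; _+_; _*_; _^_)
open import Data.Integer.Properties
  using (+-0-monoid; +-0-commutativeMonoid; +-*-semiring; +-identityʳ)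
open import Data.Integer.Tactic.RingSolver using (solve-∀)
open import Data.Nat.Base as ℕ using (ℕ; zero; suc; _≤_; z≤n; s≤s)
import Data.Nat.Properties as ℕ
open import Data.Product.Base using (∃; _,_)
open import Data.Sum.Base as Sum using (_⊎_; inj₁; inj₂; [_,_]′)
open import Data.Vec.Functional using (Vector)
open import Function.Base using (_∘_)
open import Level using (Level)
open import Relation.Binary.PropositionalEquality
  using (_≡_; refl; sym; trans; cong; cong₂; subst₂; module ≡-Reasoning)
open import Relation.Unary using (Pred)

private
  variable
    ℓ : Level
    m n : ℕ

∑ : Vector ℤ n → ℤ
∑ = sum +-0-monoid

∑-cong : {f g : Vector ℤ n} → (∀ i → f i ≡ g i) → ∑ f ≡ ∑ g
∑-cong = sum-cong-≗ +-0-monoid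

-- The pair (i , k) stands for striking out column i and then the k-th
-- remaining one; for i ≤ k the same two columns are struck out in the other
-- order by (suc k , i).
∑∑-antisymmetric : (h : Fin (suc n) → Fin n → ℤ) →
  (∀ i k → i Fin.≤ k → h (inject₁ i) k + h (suc k) i ≡ 0ℤ) →
  ∑ (λ i → ∑ (h i)) ≡ 0ℤ
∑∑-antisymmetric {zero}  h anti = refl
∑∑-antisymmetric {suc n} h anti = begin
  -- Split off the row `h zero` and the column below it. These cancel term by term, and the
  -- remaining block `rest` is antisymmetric in the same sense.
  ∑ (h zero) + ∑ (λ i → h (suc i) zero + ∑ (rest i))
    ≡⟨ cong (∑ (h zero) +_)
         (∑-distrib-+ +-0-commutativeMonoid (λ i → h (suc i) zero) (λ i → ∑ (rest i))) ⟩
  ∑ (h zero) + (∑ (λ i → h (suc i) zero) + ∑ (λ i → ∑ (rest i)))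
    ≡⟨ cong (λ x → ∑ (h zero) + (∑ (λ i → h (suc i) zero) + x))
         (∑∑-antisymmetric rest (λ i k i≤k → anti (suc i) (suc k) (s≤s i≤k))) ⟩
  ∑ (h zero) + (∑ (λ i → h (suc i) zero) + 0ℤ)
    ≡⟨ cong (∑ (h zero) +_) (+-identityʳ _) ⟩
  ∑ (h zero) + ∑ (λ i → h (suc i) zero)
    ≡⟨ ∑-distrib-+ +-0-commutativeMonoid (h zero) (λ i → h (suc i) zero) ⟨
  ∑ (λ k → h zero k + h (suc k) zero)
    ≡⟨ ∑-cong (λ k → anti zero k z≤n) ⟩
  ∑ {suc n} (λ _ → 0ℤ)
    ≡⟨ sum-replicate-zero +-0-monoid (suc n) ⟩
  0ℤ ∎
  where
  open ≡-Reasoning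
  rest : Fin (suc n) → Fin n → ℤ
  rest i k = h (suc i) (suc k)

punchIn-inject₁ : {i k : Fin n} → i Fin.≤ k → punchIn (inject₁ i) k ≡ suc k
punchIn-inject₁ {i = zero}              _         = refl
punchIn-inject₁ {i = suc _} {k = suc _} (s≤s i≤k) = cong suc (punchIn-inject₁ i≤k)

punchIn-suc : {i k : Fin n} → i Fin.≤ k → punchIn (suc k) i ≡ inject₁ i
punchIn-suc {i = zero}              _         = refl
punchIn-suc {i = suc _} {k = suc _} (s≤s i≤k) = cong suc (punchIn-suc i≤k)

-- Both sides enumerate in increasing order the columns other than `inject₁ i` and `suc k`, so the
-- two orders of striking them out leave the same minor.
punchIn-comm : {i k : Fin (suc n)} → i Fin.≤ k → ∀ x →
  punchIn (inject₁ i) (punchIn k x) ≡ punchIn (suc k) (punchIn i x)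
punchIn-comm {i = zero}              _         x       = refl
punchIn-comm {i = suc _} {k = suc _} (s≤s i≤k) zero    = refl
punchIn-comm {i = suc _} {k = suc _} (s≤s i≤k) (suc x) = cong suc (punchIn-comm i≤k x)

det-cong : {M N : Matrix n n} → (∀ i j → M i j ≡ N i j) → det M ≡ det N
det-cong {zero}  M≗N = refl
det-cong {suc n} M≗N = ∑-cong λ j →
  cong₂ (λ x d → -1ℤ ^ toℕ j * x * d) (M≗N zero j)
    (det-cong (λ i l → M≗N (suc i) (punchIn j l)))

-- Expanding along the first two rows gives a double sum over ordered pairs of struck columns.
-- Swapping the two columns keeps the minor and the product of entries, by proportionality, but
-- flips the sign.
det-proportional : (M : Matrix (suc (suc n)) (suc (suc n))) (c : ℤ) →
  (∀ j → M (suc zero) j ≡ c * M zero j) → Singular M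
det-proportional M c M₁≡cM₀ = trans
  (∑-cong λ j → *-distribˡ-sum +-*-semiring (-1ℤ ^ toℕ j * M zero j) (cofactor j))
  (∑∑-antisymmetric (λ j k → -1ℤ ^ toℕ j * M zero j * cofactor j k) cancel)
  where
  minor₂ : Fin _ → Fin _ → ℤ
  minor₂ j k = det (minor₀ (minor₀ M j) k)

  cofactor : Fin _ → Fin _ → ℤ
  cofactor j k = -1ℤ ^ toℕ k * M (suc zero) (punchIn j k) * minor₂ j k

  -- Here `s` and `t` are the powers of -1 for `i` and `k`, `x` and `y` the first-row entries in the
  -- two columns, and `d` the common minor. The factor `-1ℤ * t` is the unfolded power at `suc k`,
  -- the source of the sign change.
  identity : ∀ c s t x y d →
    s * x * (t * (c * y) * d) + (-1ℤ * t) * y * (s * (c * x) * d) ≡ 0ℤ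
  identity = solve-∀

  cancel : ∀ i k → i Fin.≤ k →
    -1ℤ ^ toℕ (inject₁ i) * M zero (inject₁ i) * cofactor (inject₁ i) k +
    -1ℤ ^ toℕ (suc k) * M zero (suc k) * cofactor (suc k) i ≡ 0ℤ
  cancel i k i≤k
    rewrite toℕ-inject₁ i
          | punchIn-inject₁ i≤k
          | punchIn-suc i≤k
          | M₁≡cM₀ (suc k)
          | M₁≡cM₀ (inject₁ i)
          | det-cong {M = minor₀ (minor₀ M (inject₁ i)) k}
                     {N = minor₀ (minor₀ M (suc k)) i}
                     (λ a b → cong (M (suc (suc a))) (punchIn-comm i≤k b))
    = identity c (-1ℤ ^ toℕ i) (-1ℤ ^ toℕ k)
        (M zero (inject₁ i)) (M zero (suc k)) (minor₂ (suc k) i)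

∅ : Selection 0 n
index      ∅ ()
increasing ∅ {()}

shift : Selection m n → Selection m (suc n)
index      (shift s)     = suc ∘ index s
increasing (shift s) i<j = s≤s (increasing s i<j)

extend : Selection m n → Selection (suc m) (suc n)
index      (extend s) zero    = zero
index      (extend s) (suc i) = suc (index s i)
increasing (extend s) {zero}  {suc j} _         = s≤s z≤n
increasing (extend s) {suc i} {suc j} (s≤s i<j) = s≤s (increasing s i<j)

initial : m ≤ n → Selection m n
index      (initial m≤n) i = inject≤ i m≤n
increasing (initial m≤n) {i} {j} =
  subst₂ ℕ._<_ (sym (toℕ-inject≤ i m≤n)) (sym (toℕ-inject≤ j m≤n))

SelectionOf : ∀ {n} → ℕ → Pred (Fin n) ℓ → Set ℓ
SelectionOf {n = n} m P = ∃ λ (s : Selection m n) → ∀ i → P (index s i)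

shift-of : (P : Pred (Fin (suc n)) ℓ) → SelectionOf m (P ∘ suc) → SelectionOf m P
shift-of P (s , Ps) = shift s , Ps

extend-of : (P : Pred (Fin (suc n)) ℓ) → P zero →
  SelectionOf m (P ∘ suc) → SelectionOf (suc m) P
extend-of P P0 (s , Ps) = extend s , λ { zero → P0 ; (suc i) → Ps i }

-- Each index in turn lowers one of the demands `a` and `b` by one, and a demand of zero is met by
-- the empty selection. The bound is `a + b - 1 ≤ n` without subtraction.
pigeonhole : ∀ a b (P Q : Pred (Fin n) ℓ) → a ℕ.+ b ≤ suc n →
  (∀ i → P i ⊎ Q i) → SelectionOf a P ⊎ SelectionOf b Q
pigeonhole zero    _    _ _ _ _ = inj₁ (∅ , λ ())
pigeonhole (suc a) zero _ _ _ _ = inj₂ (∅ , λ ())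
pigeonhole {n = zero}  (suc a) (suc b) _ _ (s≤s a+1+b≤0) _
  rewrite ℕ.+-suc a b with () ← a+1+b≤0
pigeonhole {n = suc n} (suc a) (suc b) P Q (s≤s a+1+b≤1+n) P⊎Q with P⊎Q zero
... | inj₁ P0 = Sum.map (extend-of P P0) (shift-of Q)
  (pigeonhole a (suc b) (P ∘ suc) (Q ∘ suc) a+1+b≤1+n (P⊎Q ∘ suc))
... | inj₂ Q0 = Sum.map (shift-of P) (extend-of Q Q0)
  (pigeonhole (suc a) b (P ∘ suc) (Q ∘ suc) 1+a+b≤1+n (P⊎Q ∘ suc))
  where
  1+a+b≤1+n : suc a ℕ.+ b ≤ suc n
  1+a+b≤1+n = ℕ.≤-trans (ℕ.≤-reflexive (sym (ℕ.+-suc a b))) a+1+b≤1+n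

-- Equality is written with the factor `1ℤ` so that both cases fit `det-proportional`, with `c`
-- equal to 1 or -1.
signs-proportional : ∀ {x y} → x ≡ 1ℤ ⊎ x ≡ -1ℤ → y ≡ 1ℤ ⊎ y ≡ -1ℤ →
  y ≡ 1ℤ * x ⊎ y ≡ -1ℤ * x
signs-proportional (inj₁ refl) (inj₁ refl) = inj₁ refl
signs-proportional (inj₁ refl) (inj₂ refl) = inj₂ refl
signs-proportional (inj₂ refl) (inj₁ refl) = inj₂ refl
signs-proportional (inj₂ refl) (inj₂ refl) = inj₁ refl

singular-submatrix : (A : Matrix n n) → SignMatrix A →
  2 ≤ m → m ≤ n → m ℕ.+ m ≤ suc n → HasSingularSubmatrix m A
singular-submatrix {n} {suc (suc m)} A A-sign _ m≤n 2m≤1+n =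
  rows , [ singular 1ℤ , singular -1ℤ ]′
    (pigeonhole _ _ _ _ 2m≤1+n λ j → signs-proportional (A-sign r₀ j) (A-sign r₁ j))
  where
  rows : Selection (suc (suc m)) n
  rows = initial m≤n

  r₀ r₁ : Fin n
  r₀ = index rows zero
  r₁ = index rows (suc zero)

  singular : ∀ c → SelectionOf (suc (suc m)) (λ j → A r₁ j ≡ c * A r₀ j) →
    ∃ λ cols → Singular (submatrix A rows cols)
  singular c (cols , proportional) =
    cols , det-proportional (submatrix A rows cols) c proportional
singular-submatrix {m = suc zero} _ _ (s≤s ()) _ _

m+m≤1+n₀ : ∀ m (2≤m : 2 ≤ m) (m≤6 : m ≤ 6) → m ℕ.+ m ≤ suc (n₀ m 2≤m m≤6)
m+m≤1+n₀ 1 (s≤s ()) _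
-- The last argument is the slack `n₀ + 1 - 2m`, which vanishes for `m` equal to 2 and 3.
m+m≤1+n₀ 2 _ _ = ℕ.m≤m+n 4 0
m+m≤1+n₀ 3 _ _ = ℕ.m≤m+n 6 0
m+m≤1+n₀ 4 _ _ = ℕ.m≤m+n 8 1
m+m≤1+n₀ 5 _ _ = ℕ.m≤m+n 10 6
m+m≤1+n₀ 6 _ _ = ℕ.m≤m+n 12 34
m+m≤1+n₀ (suc (suc (suc (suc (suc (suc (suc _)))))))
  _ (s≤s (s≤s (s≤s (s≤s (s≤s (s≤s ()))))))

corollary3 : ∀ (n : ℕ) (A : Matrix n n) → SignMatrix A →
    ∀ (m : ℕ) (2≤m : 2 ≤ m) (m≤6 : m ≤ 6) →
    n₀ m 2≤m m≤6 ≤ n → HasSingularSubmatrix m A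
corollary3 n A A-sign m 2≤m m≤6 n₀≤n =
  singular-submatrix A A-sign 2≤m m≤n 2m≤1+n
  where
  2m≤1+n : m ℕ.+ m ≤ suc n
  2m≤1+n = ℕ.≤-trans (m+m≤1+n₀ m 2≤m m≤6) (s≤s n₀≤n)

  m≤n : m ≤ n
  -- Since `1 ≤ m`, the chain is `1 + m ≤ m + m ≤ 1 + n`.
  m≤n = ℕ.s≤s⁻¹ (ℕ.≤-trans (ℕ.+-monoˡ-≤ m (ℕ.≤-trans (s≤s z≤n) 2≤m)) 2m≤1+n)
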